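{- Let $\textsf{AP}$ be a finite set of atomic propositions containing a proposition $p$. Then $\text{HyperLTL} \not\leq_{\textit{fin}} \text{KCTL}^*$; that is, there exists a HyperLTL sentence $\varphi$ over $\textsf{AP}$ such that for every finite set $\textsf{Agts}$ of agents, every observation map $\textit{Obs}:\textsf{Agts}\to 2^{\textsf{AP}}$ and every KCTL$^*$ sentence $\psi$ over $\textsf{Agts}$ and $\textsf{AP}$, there is a finite Kripke structure $K$ over $\textsf{AP}$ such that it is not the case that ($K\models\varphi$ iff $(K,\textit{Obs})\models\psi$).
   Context: A Kripke structure over $\textsf{AP}$ is $K=\langle S,s_0,E,V\rangle$ with state set $S$, initial state $s_0$, transition relation $E\subseteq S\times S$ such that every state has at least one successor, and valuation $V:S\to 2^{\textsf{AP}}$; it is finite if $S$ is finite. A path is an infinite sequence of states $t_0t_1\ldots$ with $(t_i,t_{i+1})\in E$; an initial path starts at $s_0$; $\pi[0,i]$ is the prefix up to position $i$. $V$ is extended to sequences of states pointwise. KCTL$^*$ (over a finite set $\textsf{Agts}$ of agents): $\varphi::=\top\mid p\mid\neg\varphi\mid\varphi\vee\varphi\mid \textsf{X}\varphi\mid\varphi\textsf{U}\varphi\mid\exists\varphi\mid \textsf{K}_a\varphi$ with $p\in\textsf{AP}$, $a\in\textsf{Agts}$; $\forall\varphi:=\neg\exists\neg\varphi$, $\textsf{F}\varphi:=\top\textsf{U}\varphi$, $\textsf{G}\varphi:=\neg\textsf{F}\neg\varphi$. A sentence is a formula in which every temporal or knowledge modality is in the scope of a path quantifier. An observation map is $\textit{Obs}:\textsf{Agts}\to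 2^{\textsf{AP}}$; two finite traces $w,w'\in(2^{\textsf{AP}})^*$ of equal length are $\textit{Obs}_a$-equivalent if $w(i)\cap\textit{Obs}(a)=w'(i)\cap\textit{Obs}(a)$ for all $i$. For an initial path $\pi$ of $K$ and $i\ge0$: $\pi,i\models p$ iff $p\in V(\pi(i))$; Boolean cases standard; $\pi,i\models\textsf{X}\varphi$ iff $\pi,i+1\models\varphi$; $\pi,i\models\varphi_1\textsf{U}\varphi_2$ iff for some $j\ge i$, $\pi,j\models\varphi_2$ and $\pi,k\models\varphi_1$ for all $k\in[i,j-1]$; $\pi,i\models\exists\varphi$ iff for some initial path $\pi'$ with $\pi'[0,i]=\pi[0,i]$, $\pi',i\models\varphi$; $\pi,i\models\textsf{K}_a\varphi$ iff for all initial paths $\pi'$ such that $V(\pi[0,i])$ and $V(\pi'[0,i])$ are $\textit{Obs}_a$-equivalent, $\pi',i\models\varphi$. $(K,\textit{Obs})\models\varphi$ iff $\pi,0\models\varphi$ for some initial path $\pi$. HyperCTL$^*$ (over a finite set $\textsf{VAR}$ of path variables): $\varphi::=\top\mid p[x]\mid\neg\varphi\mid\varphi\wedge\varphi\mid\textsf{X}\varphi\mid\varphi\textsf{U}\varphi\mid\exists x.\varphi$. Semantics w.r.t. a path assignment $\Pi$ mapping each variable to an initial path of $K$, a variable $y$ and a position $i$: $\Pi,y,i\models p[x]$ iff $p\in V(\Pi(x)(i))$; Boolean, $\textsf{X}$, $\textsf{U}$ as usual (on the position $i$); $\Pi,y,i\models\exists x.\varphi$ iff for some initial path $\pi$ with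 $\pi[0,i]=\Pi(y)[0,i]$, $\Pi[x\leftarrow\pi],x,i\models\varphi$. A sentence: every temporal modality in the scope of a quantifier and every variable in an atom $p[x]$ bound. $K\models\varphi$ iff $\Pi,y,0\models\varphi$ for some $\Pi,y$. HyperLTL is the fragment of sentences of the form $Q_1x_1.\cdots Q_nx_n.\psi$ with $Q_i\in\{\exists,\forall\}$ ($\forall x.\varphi:=\neg\exists x.\neg\varphi$) and $\psi$ quantifier-free. -}

module Defs where

open import Data.Nat using (ℕ; zero; suc; _≤_; _<_)
open import Data.Fin using (Fin)
open import Data.Fin.Subset using (Subset; _∈_; _∩_)
open import Data.Bool using (Bool; true)
open import Data.Product using (Σ; ∃; _×_; _,_)
open import Data.Sum using (_⊎_)
open import Data.Unit using (⊤)
open import Data.Empty using (⊥)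
open import Data.List using (List; []; _∷_)
open import Data.List.Membership.Propositional renaming (_∈_ to _∈ˡ_)
open import Relation.Nullary using (¬_)
open import Relation.Binary.PropositionalEquality using (_≡_; _≢_)

-- Finite Kripke structures over AP = Fin m, with state set S = Fin n.
-- Sets of propositions (elements of 2^AP) are Subset m.

record Kripke (m n : ℕ) : Set where
  field
    s₀    : Fin n
    E     : Fin n → Fin n → Bool
    total : ∀ s → ∃ λ t → E s t ≡ true
    V     : Fin n → Subset m

-- Initial paths of K (all paths used by the semantics are initial).
record IPath {m n : ℕ} (K : Kripke m n) : Set where
  open Kripke K
  field
    at   : ℕ → Fin n
    init : at 0 ≡ s₀
    step : ∀ i → E (at i) (at (suc i)) ≡ true
open IPath public

SamePrefix : ∀ {m n} {K : Kripke m n} → IPath K → IPath K → ℕ → Set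
SamePrefix π π' i = ∀ j → j ≤ i → at π j ≡ at π' j

data KForm (k m : ℕ) : Set where
  K⊤   : KForm k m
  Katom : Fin m → KForm k m
  K¬   : KForm k m → KForm k m
  _K∨_ : KForm k m → KForm k m → KForm k m
  KX   : KForm k m → KForm k m
  _KU_ : KForm k m → KForm k m → KForm k m
  K∃   : KForm k m → KForm k m
  KK   : Fin k → KForm k m → KForm k m

-- Sentences: every temporal/knowledge modality is in the scope of a path
-- quantifier.
data KSentence {k m : ℕ} : KForm k m → Set where
  s⊤   : KSentence K⊤
  satom : ∀ p → KSentence (Katom p)
  s¬   : ∀ {φ} → KSentence φ → KSentence (K¬ φ)
  s∨   : ∀ {φ ψ} → KSentence φ → KSentence ψ → KSentence (φ K∨ ψ)
  s∃   : ∀ φ → KSentence (K∃ φ)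

ObsEquiv : ∀ {k m n} (K : Kripke m n) (Obs : Fin k → Subset m) (a : Fin k)
           → IPath K → IPath K → ℕ → Set
ObsEquiv K Obs a π π' i =
  ∀ j → j ≤ i → (Kripke.V K (at π j) ∩ Obs a) ≡ (Kripke.V K (at π' j) ∩ Obs a)

_,_,_⊨K_ : ∀ {k m n} (K : Kripke m n) (Obs : Fin k → Subset m)
           → IPath K × ℕ → KForm k m → Set
K , Obs , (π , i) ⊨K K⊤ = ⊤
K , Obs , (π , i) ⊨K Katom p = p ∈ Kripke.V K (at π i)
K , Obs , (π , i) ⊨K K¬ φ = ¬ (K , Obs , (π , i) ⊨K φ)
K , Obs , (π , i) ⊨K (φ K∨ ψ) = (K , Obs , (π , i) ⊨K φ) ⊎ (K , Obs , (π , i) ⊨K ψ)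
K , Obs , (π , i) ⊨K KX φ = K , Obs , (π , suc i) ⊨K φ
K , Obs , (π , i) ⊨K (φ KU ψ) =
  ∃ λ j → i ≤ j × (K , Obs , (π , j) ⊨K ψ)
        × (∀ l → i ≤ l → l < j → K , Obs , (π , l) ⊨K φ)
K , Obs , (π , i) ⊨K K∃ φ =
  ∃ λ (π' : IPath K) → SamePrefix π' π i × (K , Obs , (π' , i) ⊨K φ)
K , Obs , (π , i) ⊨K KK a φ =
  ∀ (π' : IPath K) → ObsEquiv K Obs a π π' i → K , Obs , (π' , i) ⊨K φ

_,_⊨KCTL_ : ∀ {k m n} (K : Kripke m n) (Obs : Fin k → Subset m) → KForm k m → Set
K , Obs ⊨KCTL φ = ∃ λ (π : IPath K) → K , Obs , (π , 0) ⊨K φ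

data HForm (m v : ℕ) : Set where
  H⊤    : HForm m v
  Hatom : Fin m → Fin v → HForm m v
  H¬    : HForm m v → HForm m v
  _H∧_  : HForm m v → HForm m v → HForm m v
  HX    : HForm m v → HForm m v
  _HU_  : HForm m v → HForm m v → HForm m v
  H∃    : Fin v → HForm m v → HForm m v

H∀ : ∀ {m v} → Fin v → HForm m v → HForm m v
H∀ x φ = H¬ (H∃ x (H¬ φ))

update : ∀ {v} {A : Set} → (Fin v → A) → Fin v → A → Fin v → A
update {v} Π x a y with Data.Fin._≟_ x y
... | Relation.Nullary.yes _ = a
... | Relation.Nullary.no _ = Π y

_,_,_,_⊨H_ : ∀ {m n v} (K : Kripke m n) → (Fin v → IPath K) → Fin v → ℕ
             → HForm m v → Set
K , Π , y , i ⊨H H⊤ = ⊤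
K , Π , y , i ⊨H Hatom p x = p ∈ Kripke.V K (at (Π x) i)
K , Π , y , i ⊨H H¬ φ = ¬ (K , Π , y , i ⊨H φ)
K , Π , y , i ⊨H (φ H∧ ψ) = (K , Π , y , i ⊨H φ) × (K , Π , y , i ⊨H ψ)
K , Π , y , i ⊨H HX φ = K , Π , y , suc i ⊨H φ
K , Π , y , i ⊨H (φ HU ψ) =
  ∃ λ j → i ≤ j × (K , Π , y , j ⊨H ψ)
        × (∀ l → i ≤ l → l < j → K , Π , y , l ⊨H φ)
K , Π , y , i ⊨H H∃ x φ =
  ∃ λ (π : IPath K) → SamePrefix π (Π y) i × (K , update Π x π , x , i ⊨H φ)

_⊨HyperCTL_ : ∀ {m n v} (K : Kripke m n) → HForm m v → Set
K ⊨HyperCTL φ = ∃ λ (Π : Fin _ → IPath K) → ∃ λ y → K , Π , y , 0 ⊨H φ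

data QF {m v : ℕ} : HForm m v → Set where
  q⊤  : QF H⊤
  qat : ∀ p x → QF (Hatom p x)
  q¬  : ∀ {φ} → QF φ → QF (H¬ φ)
  q∧  : ∀ {φ ψ} → QF φ → QF ψ → QF (φ H∧ ψ)
  qX  : ∀ {φ} → QF φ → QF (HX φ)
  qU  : ∀ {φ ψ} → QF φ → QF ψ → QF (φ HU ψ)

data AtomsBound {m v : ℕ} (bs : List (Fin v)) : HForm m v → Set where
  b⊤  : AtomsBound bs H⊤
  bat : ∀ p {x} → x ∈ˡ bs → AtomsBound bs (Hatom p x)
  b¬  : ∀ {φ} → AtomsBound bs φ → AtomsBound bs (H¬ φ)
  b∧  : ∀ {φ ψ} → AtomsBound bs φ → AtomsBound bs ψ → AtomsBound bs (φ H∧ ψ)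
  bX  : ∀ {φ} → AtomsBound bs φ → AtomsBound bs (HX φ)
  bU  : ∀ {φ ψ} → AtomsBound bs φ → AtomsBound bs ψ → AtomsBound bs (φ HU ψ)

data NoTemporal {m v : ℕ} : HForm m v → Set where
  n⊤  : NoTemporal H⊤
  nat : ∀ p x → NoTemporal (Hatom p x)
  n¬  : ∀ {φ} → NoTemporal φ → NoTemporal (H¬ φ)
  n∧  : ∀ {φ ψ} → NoTemporal φ → NoTemporal ψ → NoTemporal (φ H∧ ψ)

-- HyperLTL sentences Q₁x₁. ⋯ Qₙxₙ. ψ (ψ quantifier-free), given the list
-- of variables bound by the enclosing prefix.  Sentence conditions: every
-- atom variable bound, every temporal modality in scope of a quantifier.
data HyperLTLPrefix {m v : ℕ} : List (Fin v) → HForm m v → Set where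
  body : ∀ {bs ψ} → QF ψ → AtomsBound bs ψ → (bs ≡ [] → NoTemporal ψ)
         → HyperLTLPrefix bs ψ
  ex   : ∀ {bs φ} x → HyperLTLPrefix (x ∷ bs) φ → HyperLTLPrefix bs (H∃ x φ)
  all  : ∀ {bs φ} x → HyperLTLPrefix (x ∷ bs) φ → HyperLTLPrefix bs (H∀ x φ)

IsHyperLTLSentence : ∀ {m v} → HForm m v → Set
IsHyperLTLSentence φ = HyperLTLPrefix [] φ

{-# OPTIONS --safe #-}

-- The sentence is ∃x.∃y. p[x] U (p[x] ∧ ¬p[y] ∧ X G (p[x] ↔ p[y])).  The
-- structures branch only in the initial state, into finitely many
-- eventually constant paths.  A path first spells an identifier of its own
-- and then, from time "cut" on, one of N pairwise distinct words, chosen by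
-- a surjection f from paths to words.  From the cut on, an agent observing p
-- has read the identifier and knows the path, while an agent not observing p
-- considers every path possible; hence the truth of a KCTL* formula depends
-- only on the word still to be read, and not on f.  Once N exceeds the number
-- of possible truth patterns of the subformulas of ψ, two distinct words i, j
-- satisfy at the cut the same subformulas of ψ, and ψ does not notice when a
-- path with word j gets word i instead, as long as f stays surjective.
-- The HyperLTL sentence says that the word of the distinguished path 0 (the
-- one with identifier ppp…) occurs on another path; with f 0 = j this
-- is changed by that replacement.

module Submission where

open import Defs
open import Data.Bool as Bool using (Bool; true; false; not; _∧_; if_then_else_)
open import Data.Bool.Properties using (∧-identityʳ; ∧-zeroʳ)
open import Data.Empty using (⊥; ⊥-elim)
open import Data.Fin using (Fin; zero; suc; toℕ; combine; remQuot; _≟_)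
open import Data.Fin.Properties using (suc-injective; combine-injectiveˡ; combine-injectiveʳ; remQuot-combine; combine-remQuot; toℕ-injective; toℕ<n; any?; all?; pigeonhole; <⇒≢)
open import Data.Fin.Subset using (Subset; _∩_; _∈_) renaming (⊥ to ∅)
open import Data.Fin.Subset.Properties using (_∈?_)
open import Data.List.Relation.Unary.Any using (here; there)
open import Data.Nat using (ℕ; zero; suc; _+_; _*_; _∸_; _≤_; _<_; z≤n; s≤s; _<?_; _≤?_)
open import Data.Nat.Properties as ℕ using (≤-refl; ≤-trans; <-≤-trans; ≤-<-trans; <⇒≤; n≤1+n; m≤n+m; m≤m+n; ≰⇒>; ≮⇒≥; m+n∸m≡n; n<1+n; allUpTo?; anyUpTo?)
open import Data.Product using (Σ; ∃; _×_; _,_; proj₁; proj₂)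
open import Data.Sum using (_⊎_; inj₁; inj₂)
open import Data.Unit using (⊤; tt)
open import Data.Vec using (_∷_; head; here)
open import Data.Vec.Properties using (≡-dec)
open import Function using (_∘_)
open import Function.Bundles using (_⇔_; Equivalence; mk⇔)
open import Relation.Binary.PropositionalEquality using (_≡_; _≢_; refl; sym; trans; cong; cong₂; subst; module ≡-Reasoning)
open import Relation.Nullary using (¬_; Dec; yes; no; does; contradiction)
open import Relation.Nullary.Decidable using (map′; ¬?; _×-dec_; _⊎-dec_; _→-dec_; dec-true; dec-false; decidable-stable)

-- Booleans and labels

dec⇒witness : ∀ {A : Set} (A? : Dec A) → does A? ≡ true → A
dec⇒witness (yes a) _ = a

true≢false : ∀ {b} → b ≡ true → b ≡ false → ⊥
true≢false refl ()

-- The proposition p is number `zero`. All others are false everywhere, so an observation set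
-- matters only through its `head`.
label : ∀ {m} → Bool → Subset (suc m)
label b = b ∷ ∅

label∩-cancel : ∀ {m b c} (O : Subset (suc m)) → head O ≡ true →
                label b ∩ O ≡ label c ∩ O → b ≡ c
label∩-cancel {b = b} {c} (true ∷ _) refl eq =
  trans (sym (∧-identityʳ b)) (trans (cong head eq) (∧-identityʳ c))

label∩-blind : ∀ {m} b c (O : Subset (suc m)) → head O ≡ false →
               label b ∩ O ≡ label c ∩ O
label∩-blind b c (false ∷ O) refl =
  cong (_∷ (∅ ∩ O)) (trans (∧-zeroʳ b) (sym (∧-zeroʳ c)))

-- Traces of structures that branch only at time 0

Traces : ℕ → Set
Traces P = Fin P → ℕ → Bool

module _ {k m P : ℕ} (Obs : Fin k → Subset (suc m)) where

  Indist : Traces P → Fin k → Fin P → Fin P → ℕ → Set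
  Indist tr g a b i =
    ∀ j → j ≤ i → label (tr a j) ∩ Obs g ≡ label (tr b j) ∩ Obs g

  -- The KCTL* semantics with trace indices in place of paths. At time 0 all paths share the initial
  -- state, and `K∃` ranges over all of them; later the prefix fixes the path and `K∃` is vacuous.
  Sat : Traces P → KForm k (suc m) → Fin P → ℕ → Set
  Sat tr K⊤        a i       = ⊤
  Sat tr (Katom p) a i       = p ∈ label (tr a i)
  Sat tr (K¬ φ)    a i       = ¬ Sat tr φ a i
  Sat tr (φ K∨ ψ)  a i       = Sat tr φ a i ⊎ Sat tr ψ a i
  Sat tr (KX φ)    a i       = Sat tr φ a (suc i)
  Sat tr (φ KU ψ)  a i       =
    ∃ λ j → i ≤ j × Sat tr ψ a j × (∀ l → i ≤ l → l < j → Sat tr φ a l)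
  Sat tr (K∃ φ)    a zero    = ∃ λ b → Sat tr φ b zero
  Sat tr (K∃ φ)    a (suc i) = Sat tr φ a (suc i)
  Sat tr (KK g φ)  a i       = ∀ b → Indist tr g a b i → Sat tr φ b i

  module _ (tr : Traces P) {T : ℕ}
           (stable : ∀ a {i} → suc T ≤ i → tr a i ≡ false) where

    Indist-stable : ∀ {g a b i j} → suc T ≤ i → Indist tr g a b i →
                    Indist tr g a b j
    Indist-stable {g} {a} {b} {i} T<i h l _ with l ≤? i
    ... | yes l≤i = h l l≤i
    ... | no  l≰i = cong (λ c → label c ∩ Obs g) (trans (stable a T<l) (sym (stable b T<l)))
      where T<l = ≤-trans T<i (<⇒≤ (≰⇒> l≰i))

    -- After time `T` the labels are constant and further observation teaches an agent nothing. The
    -- times `i` and `j` are unordered because negation swaps them.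
    Sat-stable : ∀ φ {a i j} → suc T ≤ i → suc T ≤ j →
                 Sat tr φ a i → Sat tr φ a j
    Sat-stable K⊤ _ _ _ = tt
    Sat-stable (Katom p) {a} T<i T<j =
      subst (λ b → p ∈ label b) (trans (stable a T<i) (sym (stable a T<j)))
    Sat-stable (K¬ φ) T<i T<j h = h ∘ Sat-stable φ T<j T<i
    Sat-stable (φ K∨ ψ) T<i T<j (inj₁ h) = inj₁ (Sat-stable φ T<i T<j h)
    Sat-stable (φ K∨ ψ) T<i T<j (inj₂ h) = inj₂ (Sat-stable ψ T<i T<j h)
    Sat-stable (KX φ) T<i T<j =
      Sat-stable φ (≤-trans T<i (n≤1+n _)) (≤-trans T<j (n≤1+n _))
    Sat-stable (φ KU ψ) T<i T<j (l , i≤l , h , _) =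
      _ , ≤-refl , Sat-stable ψ (≤-trans T<i i≤l) T<j h ,
      λ n j≤n n<j → contradiction (≤-<-trans j≤n n<j) (ℕ.<-irrefl refl)
    Sat-stable (K∃ φ) {i = suc _} {suc _} T<i T<j = Sat-stable φ T<i T<j
    Sat-stable (KK g φ) {a} T<i T<j h b a~b =
      Sat-stable φ T<i T<j (h b (Indist-stable {a = a} {b} T<j a~b))

    Indist? : ∀ g a b i → Dec (Indist tr g a b i)
    Indist? g a b i = map′
      (λ h j j≤i → h (s≤s j≤i)) (λ h {j} j<1+i → h j (ℕ.≤-pred j<1+i))
      (allUpTo? (λ j → ≡-dec Bool._≟_ (label (tr a j) ∩ Obs g)
                                           (label (tr b j) ∩ Obs g)) (suc i))

    Sat? : ∀ φ a i → Dec (Sat tr φ a i)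
    Sat? K⊤ a i = yes tt
    Sat? (Katom p) a i = p ∈? label (tr a i)
    Sat? (K¬ φ) a i = ¬? (Sat? φ a i)
    Sat? (φ K∨ ψ) a i = Sat? φ a i ⊎-dec Sat? ψ a i
    Sat? (KX φ) a i = Sat? φ a (suc i)
    Sat? (φ KU ψ) a i = map′ (λ (j , _ , h) → j , h) bounded
        (anyUpTo? (λ j → i ≤? j ×-dec Sat? ψ a j ×-dec φ-until? j) (suc (i + suc T)))
      where
      Until : ℕ → Set
      Until j = i ≤ j × Sat tr ψ a j × (∀ l → i ≤ l → l < j → Sat tr φ a l)

      φ-until? : ∀ j → Dec (∀ l → i ≤ l → l < j → Sat tr φ a l)
      φ-until? j = map′ (λ h l i≤l l<j → h l<j i≤l) (λ h {l} l<j i≤l → h l i≤l l<j)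
        (allUpTo? (λ l → i ≤? l →-dec Sat? φ a l) j)

      bounded : ∃ Until → ∃ λ j → j < suc (i + suc T) × Until j
      bounded (j , i≤j , hψ , hφ) with j <? suc (i + suc T)
      ... | yes j<b = j , j<b , i≤j , hψ , hφ
      -- A witness this late can be moved back to `i + suc T`, which is not before `i` and lies in
      -- the stable range.
      ... | no  j≮b = i + suc T , ≤-refl , m≤m+n i (suc T) ,
          Sat-stable ψ (≤-trans (m≤n+m (suc T) i) (<⇒≤ b<j)) (m≤n+m (suc T) i) hψ ,
          λ l i≤l l<b → hφ l i≤l (<-≤-trans l<b (<⇒≤ b<j))
        where b<j = ≮⇒≥ j≮b
    Sat? (K∃ φ) a zero = any? (λ b → Sat? φ b zero)
    Sat? (K∃ φ) a (suc i) = Sat? φ a (suc i)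
    Sat? (KK g φ) a i = all? (λ b → Indist? g a b i →-dec Sat? φ b i)

-- The Kripke structure of a family of traces

-- The minimum of the argument and `T`.
clamp : ∀ {T} → ℕ → Fin (suc T)
clamp zero = zero
clamp {zero} (suc i) = zero
clamp {suc T} (suc i) = suc (clamp i)

toℕ-clamp : ∀ {T i} → i ≤ T → toℕ (clamp {T} i) ≡ i
toℕ-clamp z≤n = refl
toℕ-clamp (s≤s i≤T) = cong suc (toℕ-clamp i≤T)

toℕ-clamp-≥ : ∀ {T i} → T ≤ i → toℕ (clamp {T} i) ≡ T
toℕ-clamp-≥ {i = zero} z≤n = refl
toℕ-clamp-≥ {i = suc _} z≤n = refl
toℕ-clamp-≥ (s≤s T≤i) = cong suc (toℕ-clamp-≥ T≤i)

clamp-suc : ∀ {T} i → clamp {T} (suc (toℕ (clamp {T} i))) ≡ clamp (suc i)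
clamp-suc {zero} _ = refl
clamp-suc {suc T} zero = refl
clamp-suc {suc T} (suc i) = cong suc (clamp-suc i)

module Star {m Q T : ℕ} (tr : Traces (suc Q))
            (start : ∀ a → tr a 0 ≡ true)
            (stable : ∀ a {i} → suc T ≤ i → tr a i ≡ false) where

  Inner : Set
  Inner = Fin (suc Q * suc T)

  branch : Inner → Fin (suc Q)
  branch s = proj₁ (remQuot {suc Q} (suc T) s)

  depth : Inner → Fin (suc T)
  depth s = proj₂ (remQuot {suc Q} (suc T) s)

  succ : Inner → Inner
  succ s = combine (branch s) (clamp (suc (toℕ (depth s))))

  -- State 0 is initial; state suc (combine a d) is visited by path a at
  -- time suc d, and at all later times too if d = T.
  star : Kripke (suc m) (suc (suc Q * suc T))
  star = record { s₀ = zero ; E = E′ ; total = total′ ; V = V′ }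
    where
    E′ : (s t : Fin (suc (suc Q * suc T))) → Bool
    E′ _       zero    = false
    E′ zero    (suc t) = does (depth t ≟ zero)
    E′ (suc s) (suc t) = does (t ≟ succ s)

    total′ : ∀ s → ∃ λ t → E′ s t ≡ true
    total′ zero    = suc (combine {suc Q} zero zero) ,
      dec-true (_ ≟ _) (cong proj₂ (remQuot-combine {suc Q} {suc T} zero zero))
    total′ (suc s) = suc (succ s) , dec-true (succ s ≟ succ s) refl

    V′ : Fin (suc (suc Q * suc T)) → Subset (suc m)
    V′ zero    = label true
    V′ (suc s) = label (tr (branch s) (suc (toℕ (depth s))))

  open Kripke star using (E; V)

  visit : Fin (suc Q) → ℕ → Fin (suc (suc Q * suc T))
  visit a zero    = zero
  visit a (suc i) = suc (combine a (clamp i))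

  branch-combine : ∀ a d → branch (combine a d) ≡ a
  branch-combine a d = cong proj₁ (remQuot-combine {suc Q} {suc T} a d)

  depth-combine : ∀ a d → depth (combine a d) ≡ d
  depth-combine a d = cong proj₂ (remQuot-combine {suc Q} {suc T} a d)

  succ-combine : ∀ a i → succ (combine a (clamp i)) ≡ combine a (clamp (suc i))
  succ-combine a i = cong₂ combine (branch-combine a (clamp i)) (trans
    (cong (clamp ∘ suc ∘ toℕ) (depth-combine a (clamp i))) (clamp-suc i))

  path : Fin (suc Q) → IPath star
  path a = record { at = visit a ; init = refl ; step = step′ }
    where
    step′ : ∀ i → E (visit a i) (visit a (suc i)) ≡ true
    step′ zero    = dec-true (_ ≟ _) (depth-combine a zero)
    step′ (suc i) = dec-true (_ ≟ _) (sym (succ-combine a i))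

  -- A record, so that unification can recover `π` and `a`.
  record Follows (π : IPath star) (a : Fin (suc Q)) : Set where
    constructor mkFollows
    field visits : ∀ i → at π i ≡ visit a i
  open Follows

  follows-path : ∀ a → Follows (path a) a
  follows-path a = mkFollows λ _ → refl

  edge-from-initial : ∀ t → E zero t ≡ true → ∃ λ a → t ≡ visit a 1
  edge-from-initial (suc t) e = branch t , cong suc (begin
    t                                     ≡⟨ combine-remQuot {suc Q} (suc T) t ⟨
    combine {suc Q} (branch t) (depth t)  ≡⟨ cong (combine (branch t)) (dec⇒witness (_ ≟ _) e) ⟩
    combine (branch t) zero               ∎)
    where open ≡-Reasoning

  edge-from-inner : ∀ s t → E (suc s) t ≡ true → t ≡ suc (succ s)
  edge-from-inner s (suc t) e = cong suc (dec⇒witness (_ ≟ _) e)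

  -- The first step selects a branch; every later state has exactly one successor.
  follows : ∀ π → ∃ (Follows π)
  follows π = a , mkFollows go
    where
    first : ∃ λ a → at π 1 ≡ visit a 1
    first = edge-from-initial (at π 1)
      (subst (λ s → E s (at π 1) ≡ true) (init π) (step π 0))

    a = proj₁ first

    go : ∀ i → at π i ≡ visit a i
    go zero          = init π
    go (suc zero)    = proj₂ first
    go (suc (suc i)) = trans
      (edge-from-inner _ _ (subst (λ s → E s (at π (suc (suc i))) ≡ true)
                                  (go (suc i)) (step π (suc i))))
      (cong suc (succ-combine a i))

  visit-injective : ∀ {a b i} → visit a (suc i) ≡ visit b (suc i) → a ≡ b
  visit-injective {a} {b} {i} eq = combine-injectiveˡ a (clamp i) b (clamp i)
    (suc-injective eq)

  -- Depth `T` stands for all times after `T`, and there the trace is constant.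
  tr-clamp : ∀ a i → tr a (suc (toℕ (clamp {T} i))) ≡ tr a (suc i)
  tr-clamp a i with i ≤? T
  ... | yes i≤T = cong (tr a ∘ suc) (toℕ-clamp i≤T)
  ... | no  i≰T = trans
    (stable a (s≤s (ℕ.≤-reflexive (sym (toℕ-clamp-≥ T≤i)))))
    (sym (stable a (s≤s T≤i)))
    where T≤i = <⇒≤ (≰⇒> i≰T)

  V-visit : ∀ a i → V (visit a i) ≡ label (tr a i)
  V-visit a zero = cong label (sym (start a))
  V-visit a (suc i) = cong label (trans
    (cong₂ (λ b d → tr b (suc (toℕ d))) (branch-combine a (clamp i)) (depth-combine a (clamp i)))
    (tr-clamp a i))

  V-at : ∀ {π a} → Follows π a → ∀ i → V (at π i) ≡ label (tr a i)
  V-at {a = a} π~a i = trans (cong V (visits π~a i)) (V-visit a i)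

  module _ {k : ℕ} (Obs : Fin k → Subset (suc m)) where

    Indist⇒ObsEquiv : ∀ {g π ρ a b i} → Follows π a → Follows ρ b →
      Indist Obs tr g a b i → ObsEquiv star Obs g π ρ i
    Indist⇒ObsEquiv π~a ρ~b h j j≤i
      rewrite V-at π~a j | V-at ρ~b j = h j j≤i

    ObsEquiv⇒Indist : ∀ {g π ρ a b i} → Follows π a → Follows ρ b →
      ObsEquiv star Obs g π ρ i → Indist Obs tr g a b i
    ObsEquiv⇒Indist π~a ρ~b h j j≤i with h j j≤i
    ... | eq rewrite V-at π~a j | V-at ρ~b j = eq

    -- One induction proves both directions, as negation exchanges them.
    ⊨⇒Sat : ∀ φ {π a i} → Follows π a → star , Obs , (π , i) ⊨K φ → Sat Obs tr φ a i
    Sat⇒⊨ : ∀ φ {π a i} → Follows π a → Sat Obs tr φ a i → star , Obs , (π , i) ⊨K φ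

    ⊨⇒Sat K⊤ _ _ = tt
    ⊨⇒Sat (Katom p) {i = i} π~a h = subst (p ∈_) (V-at π~a i) h
    ⊨⇒Sat (K¬ φ) π~a h = h ∘ Sat⇒⊨ φ π~a
    ⊨⇒Sat (φ K∨ ψ) π~a (inj₁ h) = inj₁ (⊨⇒Sat φ π~a h)
    ⊨⇒Sat (φ K∨ ψ) π~a (inj₂ h) = inj₂ (⊨⇒Sat ψ π~a h)
    ⊨⇒Sat (KX φ) π~a h = ⊨⇒Sat φ π~a h
    ⊨⇒Sat (φ KU ψ) π~a (j , i≤j , hψ , hφ) =
      j , i≤j , ⊨⇒Sat ψ π~a hψ , λ l i≤l l<j → ⊨⇒Sat φ π~a (hφ l i≤l l<j)
    ⊨⇒Sat (K∃ φ) {i = zero} π~a (ρ , _ , h) =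
      proj₁ (follows ρ) , ⊨⇒Sat φ (proj₂ (follows ρ)) h
    -- `ρ` and `π` share a state other than the initial one, and such a state belongs to a single
    -- branch.
    ⊨⇒Sat (K∃ φ) {π} {a} {suc i} π~a (ρ , same , h) with follows ρ
    ... | b , ρ~b = subst (λ c → Sat Obs tr φ c (suc i)) b≡a (⊨⇒Sat φ ρ~b h)
      where
      b≡a : b ≡ a
      b≡a = visit-injective {i = i}
        (trans (sym (visits ρ~b (suc i))) (trans (same (suc i) ≤-refl) (visits π~a (suc i))))
    ⊨⇒Sat (KK g φ) π~a h b a~b =
      ⊨⇒Sat φ (follows-path b) (h (path b) (Indist⇒ObsEquiv π~a (follows-path b) a~b))

    Sat⇒⊨ K⊤ _ _ = tt
    Sat⇒⊨ (Katom p) {i = i} π~a h = subst (p ∈_) (sym (V-at π~a i)) h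
    Sat⇒⊨ (K¬ φ) π~a h = h ∘ ⊨⇒Sat φ π~a
    Sat⇒⊨ (φ K∨ ψ) π~a (inj₁ h) = inj₁ (Sat⇒⊨ φ π~a h)
    Sat⇒⊨ (φ K∨ ψ) π~a (inj₂ h) = inj₂ (Sat⇒⊨ ψ π~a h)
    Sat⇒⊨ (KX φ) π~a h = Sat⇒⊨ φ π~a h
    Sat⇒⊨ (φ KU ψ) π~a (j , i≤j , hψ , hφ) =
      j , i≤j , Sat⇒⊨ ψ π~a hψ , λ l i≤l l<j → Sat⇒⊨ φ π~a (hφ l i≤l l<j)
    Sat⇒⊨ (K∃ φ) {π} {i = zero} π~a (b , h) =
      path b , (λ { zero z≤n → sym (init π) }) , Sat⇒⊨ φ (follows-path b) h
    Sat⇒⊨ (K∃ φ) {π} {i = suc i} π~a h = π , (λ _ _ → refl) , Sat⇒⊨ φ π~a h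
    Sat⇒⊨ (KK g φ) π~a h ρ π~ρ with follows ρ
    ... | b , ρ~b = Sat⇒⊨ φ ρ~b (h b (ObsEquiv⇒Indist π~a ρ~b π~ρ))

    ⊨KCTL⇔Sat : ∀ ψ → (star , Obs ⊨KCTL ψ) ⇔ (∃ λ a → Sat Obs tr ψ a 0)
    ⊨KCTL⇔Sat ψ = mk⇔
      (λ (π , h) → proj₁ (follows π) , ⊨⇒Sat ψ (proj₂ (follows π)) h)
      (λ (a , h) → path a , Sat⇒⊨ ψ (follows-path a) h)

-- The HyperLTL sentence

pˣ pʸ same : ∀ {m} → HForm (suc m) 2
pˣ = Hatom zero zero
pʸ = Hatom zero (suc zero)
same = H¬ (pˣ H∧ H¬ pʸ) H∧ H¬ (pʸ H∧ H¬ pˣ)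

always : ∀ {m v} → HForm m v → HForm m v
always φ = H¬ (H⊤ HU (H¬ φ))

merging : ∀ {m} → HForm (suc m) 2
merging = H∃ zero (H∃ (suc zero)
  (pˣ HU ((pˣ H∧ H¬ pʸ) H∧ HX (always same))))

merging-sentence : ∀ {m} → IsHyperLTLSentence (merging {m})
merging-sentence = ex zero (ex (suc zero) (body
  (qU qx (q∧ (q∧ qx (q¬ qy)) (qX (q¬ (qU q⊤ (q¬
    (q∧ (q¬ (q∧ qx (q¬ qy))) (q¬ (q∧ qy (q¬ qx))))))))))
  (bU bx (b∧ (b∧ bx (b¬ by)) (bX (b¬ (bU b⊤ (b¬
    (b∧ (b¬ (b∧ bx (b¬ by))) (b¬ (b∧ by (b¬ bx))))))))))
  λ ()))
  where
  qx = qat zero zero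
  qy = qat zero (suc zero)
  bx = bat zero (there (here refl))
  by = bat zero (here refl)

-- `l` is the time at which the until of `merging` is fulfilled.
Merging : ∀ {P} → Traces P → Set
Merging tr = ∃ λ a → ∃ λ b → ∃ λ l →
  (∀ i → i < l → tr a i ≡ true) × tr a l ≡ true × tr b l ≡ false ×
  (∀ i → l < i → tr a i ≡ tr b i)

module _ {m Q T : ℕ} (tr : Traces (suc Q))
         (start : ∀ a → tr a 0 ≡ true)
         (stable : ∀ a {i} → suc T ≤ i → tr a i ≡ false) where

  open Star {m} tr start stable

  open Kripke star using (V)

  private
    to : ∀ {π a} → Follows π a → ∀ {i} → zero ∈ V (at π i) → tr a i ≡ true
    to {a = a} π~a {i} h with tr a i | subst (zero ∈_) (V-at π~a i) h
    ... | true | here = refl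

    from : ∀ {π a} → Follows π a → ∀ {i} → tr a i ≡ true → zero ∈ V (at π i)
    from {a = a} π~a {i} h =
      subst (zero ∈_) (sym (V-at π~a i)) (subst (λ b → zero ∈ label b) (sym h) here)

  ⊨merging⇒Merging : star ⊨HyperCTL merging → Merging tr
  ⊨merging⇒Merging (_ , _ , π , _ , ρ , _ , l , _ , ((pl , ¬pl) , later) , before)
    with follows π | follows ρ
  ... | a , π~a | b , ρ~b =
    a , b , l , (λ i i<l → to π~a (before i z≤n i<l)) , to π~a pl , tr-b-l , agree
    where
    tr-b-l : tr b l ≡ false
    tr-b-l with tr b l in eq
    ... | true  = contradiction (from ρ~b eq) ¬pl
    ... | false = refl

    agree : ∀ i → l < i → tr a i ≡ tr b i
    -- `always` only refutes disagreement, which suffices because equality of Booleans is decidable.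
    agree i l<i = decidable-stable (_ Bool.≟ _) λ a≢b → later
      (i , l<i ,
       (λ (x⇒y , y⇒x) → a≢b (iff x⇒y y⇒x)) ,
       λ _ _ _ → tt)
      where
      iff : ¬ (zero ∈ V (at π i) × ¬ (zero ∈ V (at ρ i))) →
            ¬ (zero ∈ V (at ρ i) × ¬ (zero ∈ V (at π i))) → tr a i ≡ tr b i
      iff x⇒y y⇒x with tr a i in eqa | tr b i in eqb
      ... | true  | true  = refl
      ... | false | false = refl
      ... | true  | false = contradiction
        (from π~a eqa , λ h → true≢false (to ρ~b h) eqb) x⇒y
      ... | false | true  = contradiction
        (from ρ~b eqb , λ h → true≢false (to π~a h) eqa) y⇒x

  Merging⇒⊨merging : Merging tr → star ⊨HyperCTL merging
  Merging⇒⊨merging (a , b , l , before , al , bl , agree) =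
    -- The quantifiers are evaluated at time 0, where all paths are in the initial state, so the
    -- prefix conditions hold for any choice of paths.
    (λ _ → path a) , zero ,
    path a , (λ _ _ → refl) , path b , (λ { zero z≤n → refl }) ,
    l , z≤n ,
    ((from πa al , λ h → true≢false (to πb h) bl) ,
     λ (i , l<i , differ , _) → differ
       ((λ (x , ¬y) → ¬y (from πb (trans (sym (agree i l<i)) (to πa x)))) ,
        (λ (y , ¬x) → ¬x (from πa (trans (agree i l<i) (to πb y)))))) ,
    λ i _ i<l → from πa (before i i<l)
    where
    πa = follows-path a
    πb = follows-path b

-- Truth patterns of the subformulas of a formula

-- Counts the assignments of truth values to the subformula occurrences, with a factor 2 for each.
-- Patterns are coded in `Fin` for the sake of the pigeonhole principle.
#patterns #subpatterns : ∀ {k m} → KForm k m → ℕ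
#patterns φ = 2 * #subpatterns φ

#subpatterns K⊤        = 1
#subpatterns (Katom p) = 1
#subpatterns (K¬ φ)    = #patterns φ
#subpatterns (φ K∨ ψ)  = #patterns φ * #patterns ψ
#subpatterns (KX φ)    = #patterns φ
#subpatterns (φ KU ψ)  = #patterns φ * #patterns ψ
#subpatterns (K∃ φ)    = #patterns φ
#subpatterns (KK g φ)  = #patterns φ

bit : Bool → Fin 2
bit false = zero
bit true  = suc zero

bit-injective : ∀ {b c} → bit b ≡ bit c → b ≡ c
bit-injective {false} {false} _ = refl
bit-injective {true}  {true}  _ = refl

module _ {k m : ℕ} where

  pattern-of : (KForm k m → Bool) → ∀ φ → Fin (#patterns φ)
  subpattern-of : (KForm k m → Bool) → ∀ φ → Fin (#subpatterns φ)

  pattern-of v φ = combine (bit (v φ)) (subpattern-of v φ)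

  subpattern-of v K⊤        = zero
  subpattern-of v (Katom p) = zero
  subpattern-of v (K¬ φ)    = pattern-of v φ
  subpattern-of v (φ K∨ ψ)  = combine (pattern-of v φ) (pattern-of v ψ)
  subpattern-of v (KX φ)    = pattern-of v φ
  subpattern-of v (φ KU ψ)  = combine (pattern-of v φ) (pattern-of v ψ)
  subpattern-of v (K∃ φ)    = pattern-of v φ
  subpattern-of v (KK g φ)  = pattern-of v φ

  record SamePattern (v v′ : KForm k m → Bool) (φ : KForm k m) : Set where
    constructor same-pattern
    field pattern-≡ : pattern-of v φ ≡ pattern-of v′ φ
  open SamePattern public

  SameSubpatterns : (v v′ : KForm k m → Bool) → KForm k m → Set
  SameSubpatterns v v′ K⊤        = ⊤
  SameSubpatterns v v′ (Katom p) = ⊤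
  SameSubpatterns v v′ (K¬ φ)    = SamePattern v v′ φ
  SameSubpatterns v v′ (φ K∨ ψ)  = SamePattern v v′ φ × SamePattern v v′ ψ
  SameSubpatterns v v′ (KX φ)    = SamePattern v v′ φ
  SameSubpatterns v v′ (φ KU ψ)  = SamePattern v v′ φ × SamePattern v v′ ψ
  SameSubpatterns v v′ (K∃ φ)    = SamePattern v v′ φ
  SameSubpatterns v v′ (KK g φ)  = SamePattern v v′ φ

  module _ {v v′ : KForm k m → Bool} where

    pattern-sym : ∀ {φ} → SamePattern v v′ φ → SamePattern v′ v φ
    pattern-sym same = same-pattern (sym (pattern-≡ same))

    pattern-root : ∀ {φ} → SamePattern v v′ φ → v φ ≡ v′ φ
    pattern-root {φ} same = bit-injective (combine-injectiveˡ
      (bit (v φ)) (subpattern-of v φ) (bit (v′ φ)) (subpattern-of v′ φ) (pattern-≡ same))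

    pattern-pair : ∀ φ ψ →
      combine (pattern-of v φ) (pattern-of v ψ) ≡ combine (pattern-of v′ φ) (pattern-of v′ ψ) →
      SamePattern v v′ φ × SamePattern v v′ ψ
    pattern-pair φ ψ eq =
      same-pattern (combine-injectiveˡ (pattern-of v φ) (pattern-of v ψ) _ _ eq) ,
      same-pattern (combine-injectiveʳ (pattern-of v φ) (pattern-of v ψ) _ _ eq)

    -- `combine` is injective, so equal codes have equal components.
    subpatterns : ∀ {φ} → SamePattern v v′ φ → SameSubpatterns v v′ φ
    subpatterns {φ} same = go φ (combine-injectiveʳ
      (bit (v φ)) (subpattern-of v φ) (bit (v′ φ)) (subpattern-of v′ φ) (pattern-≡ same))
      where
      go : ∀ φ → subpattern-of v φ ≡ subpattern-of v′ φ → SameSubpatterns v v′ φ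
      go K⊤        _  = tt
      go (Katom p) _  = tt
      go (K¬ φ)    eq = same-pattern eq
      go (φ K∨ ψ)  eq = pattern-pair φ ψ eq
      go (KX φ)    eq = same-pattern eq
      go (φ KU ψ)  eq = pattern-pair φ ψ eq
      go (K∃ φ)    eq = same-pattern eq
      go (KK g φ)  eq = same-pattern eq

-- Identifiers followed by words

module Words (N : ℕ) where

  cut : ℕ
  cut = suc (suc N)

  -- Identifiers occupy the times 0 to N + 1. The hole at w + 1 tells `suc w` from the other
  -- successors, and the hole at N + 1, just before the cut, is common to all paths but `zero`. Time
  -- 0 has no hole, as the initial state is shared.
  ident : Fin (suc N) → ℕ → Bool
  ident zero    i = true
  ident (suc w) i =
    not (does (i ℕ.≟ suc (toℕ w))) ∧ not (does (i ℕ.≟ suc N))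

  -- The single p is never at position 0, so every path lacks p at the cut itself.
  word : Fin N → ℕ → Bool
  word w d = does (d ℕ.≟ suc (toℕ w))

  traces : (Fin (suc N) → Fin N) → Traces (suc N)
  traces f a i = if does (i <? cut) then ident a i else word (f a) (i ∸ cut)

  traces-early : ∀ f a {i} → i < cut → traces f a i ≡ ident a i
  traces-early f a {i} i<c =
    cong (if_then ident a i else word (f a) (i ∸ cut)) (dec-true (i <? cut) i<c)

  traces-late : ∀ f a {i} → cut ≤ i → traces f a i ≡ word (f a) (i ∸ cut)
  traces-late f a {i} c≤i =
    cong (if_then ident a i else word (f a) (i ∸ cut)) (dec-false (i <? cut) (ℕ.≤⇒≯ c≤i))

  traces-start : ∀ f a → traces f a 0 ≡ true
  traces-start f zero    = refl
  traces-start f (suc w) = refl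

  end : ℕ
  -- The last p of any word comes at most N steps after the cut, hence no later than 2N + 2.
  end = suc N + suc N

  traces-stable : ∀ f a {i} → suc end ≤ i → traces f a i ≡ false
  traces-stable f a {i} e≤i = trans
    (traces-late f a (≤-trans (m≤m+n cut (suc N)) e≤i))
    (dec-false (_ ℕ.≟ _) λ eq → ℕ.<-irrefl (sym eq)
      (<-≤-trans (s≤s (toℕ<n (f a)))
        (subst (_≤ i ∸ cut) (m+n∸m≡n cut (suc N)) (ℕ.∸-monoˡ-≤ cut e≤i))))

  ident-end : ∀ w → ident (suc w) (suc N) ≡ false
  ident-end w rewrite dec-true (suc N ℕ.≟ suc N) refl = ∧-zeroʳ _

  ident-own : ∀ w → ident (suc w) (suc (toℕ w)) ≡ false
  ident-own w rewrite dec-true (suc (toℕ w) ℕ.≟ suc (toℕ w)) refl = refl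

  -- Up to time N the only hole of `suc w` is at w + 1, and v + 1 is at most N.
  ident-other : ∀ v w → ident (suc w) (suc (toℕ v)) ≡ false → v ≡ w
  ident-other v w h with v ≟ w
  ... | yes v≡w = v≡w
  ... | no  v≢w = ⊥-elim (true≢false
    (cong₂ (λ b c → not b ∧ not c)
      (dec-false (suc (toℕ v) ℕ.≟ suc (toℕ w)) (v≢w ∘ toℕ-injective ∘ ℕ.suc-injective))
      (dec-false (suc (toℕ v) ℕ.≟ suc N) (ℕ.<⇒≢ (s≤s (toℕ<n v)))))
    h)

  ident-injective : ∀ a b → (∀ i → i < cut → ident a i ≡ ident b i) → a ≡ b
  ident-injective zero    zero    h = refl
  ident-injective zero    (suc w) h =
    ⊥-elim (true≢false (sym (h (suc N) ≤-refl)) (ident-end w))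
  ident-injective (suc v) zero    h =
    ⊥-elim (true≢false (h (suc N) ≤-refl) (ident-end v))
  ident-injective (suc v) (suc w) h = cong suc (ident-other v w
    (trans (sym (h (suc (toℕ v)) (s≤s (<⇒≤ (s≤s (toℕ<n v)))))) (ident-own v)))

  traces-word : ∀ f a d → traces f a (cut + d) ≡ word (f a) d
  traces-word f a d = trans (traces-late f a (m≤m+n cut d))
                            (cong (word (f a)) (m+n∸m≡n cut d))

  Onto : (Fin (suc N) → Fin N) → Set
  Onto f = ∀ w → ∃ λ a → f a ≡ w

  merging-traces : ∀ f w → f zero ≡ f (suc w) → Merging (traces f)
  merging-traces f w eq =
    -- The last time before the cut: path `zero` has p there and path `suc w` has its second hole.
    zero , suc w , suc N ,
    (λ i i<l → traces-early f zero (<⇒≤ (s≤s i<l))) ,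
    traces-early f zero ≤-refl ,
    trans (traces-early f (suc w) ≤-refl) (ident-end w) ,
    λ i c≤i → trans (traces-late f zero c≤i) (trans
      (cong (λ v → word v (i ∸ cut)) eq) (sym (traces-late f (suc w) c≤i)))

  -- Let x and y be the two paths. If x is path `zero`, the common hole at N + 1 forces `l` to be N
  -- + 1, and then y reads the word of x. If x is `suc v`, its own hole comes after `l`, so y shares
  -- that hole; path `zero` has none, hence y is x, although they differ at `l`.
  ¬merging-traces : ∀ f → (∀ w → f zero ≢ f (suc w)) → ¬ Merging (traces f)
  ¬merging-traces f unique (a , b , l , before , al , bl , agree) = absurd a b l<cut before′ al bl agree
    where
    before′ : ∀ i → i ≤ l → traces f a i ≡ true
    before′ i i≤l with ℕ.m≤n⇒m<n∨m≡n i≤l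
    ... | inj₁ i<l  = before i i<l
    ... | inj₂ refl = al

    l<cut : l < cut
    l<cut with l <? cut
    ... | yes l<c = l<c
    -- Otherwise p would hold at the cut, but every word starts without p.
    ... | no  l≮c = ⊥-elim (true≢false (before′ cut (≮⇒≥ l≮c))
      (trans (traces-late f a ≤-refl) (cong (word (f a)) (ℕ.n∸n≡0 cut))))

    absurd : ∀ a b → l < cut → (∀ i → i ≤ l → traces f a i ≡ true) →
      traces f a l ≡ true → traces f b l ≡ false →
      (∀ i → l < i → traces f a i ≡ traces f b i) → ⊥
    absurd zero zero l<c _ al bl _ = true≢false al bl
    absurd zero (suc w) (s≤s l≤N) _ al bl agree with ℕ.m≤n⇒m<n∨m≡n l≤N
    ... | inj₁ l<1+N = true≢false
      (trans (sym (agree (suc N) l<1+N)) (traces-early f zero ≤-refl))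
      (trans (traces-early f (suc w) ≤-refl) (ident-end w))
    -- Compare the two paths where the word of path `zero` has its p: a word with p at that position
    -- is the same word.
    ... | inj₂ refl = unique w (toℕ-injective (ℕ.suc-injective
      (dec⇒witness (_ ℕ.≟ _) (begin
        word (f (suc w)) d           ≡⟨ traces-word f (suc w) d ⟨
        traces f (suc w) (cut + d)   ≡⟨ agree (cut + d) (m≤m+n cut d) ⟨
        traces f zero (cut + d)      ≡⟨ traces-word f zero d ⟩
        word (f zero) d              ≡⟨ dec-true (d ℕ.≟ d) refl ⟩
        true                         ∎))))
      where
      open ≡-Reasoning
      d = suc (toℕ (f zero))
    absurd (suc v) b l<c before al bl agree = case-b b bl agree
      where
      v<cut : suc (toℕ v) < cut
      v<cut = <⇒≤ (s≤s (s≤s (toℕ<n v)))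

      own : traces f (suc v) (suc (toℕ v)) ≡ false
      own = trans (traces-early f (suc v) v<cut) (ident-own v)

      l<v : l < suc (toℕ v)
      l<v = ≰⇒> λ v≤l → true≢false (before _ v≤l) own

      case-b : ∀ b → traces f b l ≡ false →
               (∀ i → l < i → traces f (suc v) i ≡ traces f b i) → ⊥
      case-b zero bl agree = true≢false (traces-early f zero l<c) bl
      case-b (suc w) bl agree
        with ident-other v w (trans (sym (traces-early f (suc w) v<cut))
                                    (trans (sym (agree _ l<v)) own))
      ... | refl = true≢false al bl

  -- Truth in the structures of identifiers and words

  module _ {k m : ℕ} (Obs : Fin k → Subset (suc m)) where

    Indist-late : ∀ f {g a b i} → head (Obs g) ≡ true → cut ≤ i →
                  Indist Obs (traces f) g a b i → a ≡ b
    Indist-late f {g} {a} {b} sees c≤i h = ident-injective a b λ j j<c →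
      trans (sym (traces-early f a j<c))
        (trans (label∩-cancel (Obs g) sees (h j (≤-trans (<⇒≤ j<c) c≤i)))
               (traces-early f b j<c))

    Indist-early : ∀ f f′ {g a b i} → i < cut →
      Indist Obs (traces f) g a b i → Indist Obs (traces f′) g a b i
    Indist-early f f′ {g} {a} {b} i<c h j j≤i =
      trans (same-label a) (trans (h j j≤i) (sym (same-label b)))
      where
      same-label : ∀ c → label (traces f′ c j) ∩ Obs g ≡ label (traces f c j) ∩ Obs g
      same-label c = cong (λ x → label x ∩ Obs g)
        (trans (traces-early f′ c j<c) (sym (traces-early f c j<c)))
        where j<c = ≤-<-trans j≤i i<c

    -- The identifiers of `a` and `a′` may differ, since only the remaining word matters. Both
    -- assignments must be onto, because negation swaps them.
    Sat-late : ∀ f f′ → Onto f → Onto f′ → ∀ φ {a a′ i} → cut ≤ i → f a ≡ f′ a′ →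
           Sat Obs (traces f) φ a i → Sat Obs (traces f′) φ a′ i
    Sat-late f f′ on on′ K⊤ c≤i eq h = tt
    Sat-late f f′ on on′ (Katom p) {a} {a′} {i} c≤i eq = subst (λ b → p ∈ label b)
      (trans (traces-late f a c≤i)
        (trans (cong (λ w → word w (i ∸ cut)) eq) (sym (traces-late f′ a′ c≤i))))
    Sat-late f f′ on on′ (K¬ φ) c≤i eq h = h ∘ Sat-late f′ f on′ on φ c≤i (sym eq)
    Sat-late f f′ on on′ (φ K∨ ψ) c≤i eq (inj₁ h) = inj₁ (Sat-late f f′ on on′ φ c≤i eq h)
    Sat-late f f′ on on′ (φ K∨ ψ) c≤i eq (inj₂ h) = inj₂ (Sat-late f f′ on on′ ψ c≤i eq h)
    Sat-late f f′ on on′ (KX φ) c≤i eq = Sat-late f f′ on on′ φ (≤-trans c≤i (n≤1+n _)) eq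
    Sat-late f f′ on on′ (φ KU ψ) c≤i eq (j , i≤j , hψ , hφ) =
      j , i≤j , Sat-late f f′ on on′ ψ (≤-trans c≤i i≤j) eq hψ ,
      λ l i≤l l<j → Sat-late f f′ on on′ φ (≤-trans c≤i i≤l) eq (hφ l i≤l l<j)
    Sat-late f f′ on on′ (K∃ φ) {i = suc _} c≤i eq = Sat-late f f′ on on′ φ c≤i eq
    Sat-late f f′ on on′ (KK g φ) {a} {a′} c≤i eq h b′ a′~b′ with head (Obs g) in sees
    -- The agent has read the whole identifier, so `a′` is the only path it considers possible; `h`
    -- is used at `a` itself.
    ... | true with refl ← Indist-late f′ {g} {a′} {b′} sees c≤i a′~b′ =
      Sat-late f f′ on on′ φ c≤i eq (h a λ _ _ → refl)
    -- The agent sees nothing, so `h` applies to every path, and `f` being onto supplies one with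
    -- the word of `b′`.
    ... | false with b , fb≡ ← on (f′ b′) =
      Sat-late f f′ on on′ φ c≤i fb≡ (h b λ _ _ → label∩-blind _ _ (Obs g) sees)

    module _ (base : Fin (suc N) → Fin N) (base-suc : ∀ w → base (suc w) ≡ w) where

      base-onto : Onto base
      base-onto w = suc w , base-suc w

      abstract
        -- The truth value at the cut depends only on the word, by `Sat-late`, and can thus be read
        -- off one reference assignment `base`, in which path `suc w` has word w.
        holds : Fin N → KForm k (suc m) → Bool
        holds w φ = does (Sat? Obs (traces base) (traces-stable base) φ (suc w) cut)

        holds-sound : ∀ f → Onto f → ∀ φ {a} → holds (f a) φ ≡ true →
                      Sat Obs (traces f) φ a cut
        holds-sound f on φ h =
          Sat-late base f base-onto on φ ≤-refl (base-suc _) (dec⇒witness (Sat? Obs _ _ φ _ _) h)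

        holds-complete : ∀ f → Onto f → ∀ φ {a} → Sat Obs (traces f) φ a cut →
                         holds (f a) φ ≡ true
        holds-complete f on φ h =
          dec-true (Sat? Obs _ _ φ _ _) (Sat-late f base on base-onto φ ≤-refl (sym (base-suc _)) h)

      Alike : (f f′ : Fin (suc N) → Fin N) → KForm k (suc m) → Set
      Alike f f′ φ = ∀ a → SamePattern (holds (f a)) (holds (f′ a)) φ

      at-cut : ∀ f f′ → Onto f → Onto f′ → ∀ φ → Alike f f′ φ → ∀ {a} →
               Sat Obs (traces f) φ a cut → Sat Obs (traces f′) φ a cut
      at-cut f f′ on on′ φ al {a} h = holds-sound f′ on′ φ
        (trans (sym (pattern-root (al a))) (holds-complete f on φ h))

      -- Up to the cut the path keeps its index, because identifiers do not depend on the
      -- assignment. An evaluation that reaches the cut is settled there by the equal patterns.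
      Sat-early : ∀ f f′ → Onto f → Onto f′ → ∀ φ → Alike f f′ φ → ∀ {a i} → i ≤ cut →
              Sat Obs (traces f) φ a i → Sat Obs (traces f′) φ a i
      before-cut : ∀ f f′ → Onto f → Onto f′ → ∀ φ → Alike f f′ φ → ∀ {a i} → i < cut →
                   Sat Obs (traces f) φ a i → Sat Obs (traces f′) φ a i

      Sat-early f f′ on on′ φ al i≤c with ℕ.m≤n⇒m<n∨m≡n i≤c
      ... | inj₁ i<c  = before-cut f f′ on on′ φ al i<c
      ... | inj₂ refl = at-cut f f′ on on′ φ al

      before-cut f f′ on on′ K⊤ al i<c h = tt
      before-cut f f′ on on′ (Katom p) al {a} i<c = subst (λ b → p ∈ label b)
        (trans (traces-early f a i<c) (sym (traces-early f′ a i<c)))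
      before-cut f f′ on on′ (K¬ φ) al i<c h =
        h ∘ before-cut f′ f on′ on φ (λ a → pattern-sym (subpatterns (al a))) i<c
      before-cut f f′ on on′ (φ K∨ ψ) al i<c (inj₁ h) =
        inj₁ (before-cut f f′ on on′ φ (proj₁ ∘ subpatterns ∘ al) i<c h)
      before-cut f f′ on on′ (φ K∨ ψ) al i<c (inj₂ h) =
        inj₂ (before-cut f f′ on on′ ψ (proj₂ ∘ subpatterns ∘ al) i<c h)
      before-cut f f′ on on′ (KX φ) al i<c =
        Sat-early f f′ on on′ φ (subpatterns ∘ al) i<c
      before-cut f f′ on on′ (φ KU ψ) al {a} {i} i<c (j , i≤j , hψ , hφ)
        with j <? cut
      ... | yes j<c = j , i≤j ,
        before-cut f f′ on on′ ψ (proj₂ ∘ subpatterns ∘ al) j<c hψ ,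
        λ l i≤l l<j → before-cut f f′ on on′ φ
          (proj₁ ∘ subpatterns ∘ al) (ℕ.<-trans l<j j<c) (hφ l i≤l l<j)
      ... | no  j≮c
        -- The witness lies beyond the cut, so the until already holds at the cut and is carried
        -- over there as a whole. This may give a different witness `j′`; the times before the cut
        -- are treated by induction.
        with j′ , c≤j′ , hψ′ , hφ′ ← at-cut f f′ on on′ (φ KU ψ) al
               (j , ≮⇒≥ j≮c , hψ , λ l c≤l → hφ l (≤-trans (<⇒≤ i<c) c≤l)) =
        j′ , ≤-trans (<⇒≤ i<c) c≤j′ , hψ′ , hφ″
        where
        hφ″ : ∀ l → i ≤ l → l < j′ → Sat Obs (traces f′) φ a l
        hφ″ l i≤l l<j′ with l <? cut
        ... | yes l<c = before-cut f f′ on on′ φ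
          (proj₁ ∘ subpatterns ∘ al) l<c
          (hφ l i≤l (<-≤-trans l<c (≮⇒≥ j≮c)))
        ... | no  l≮c = hφ′ l (≮⇒≥ l≮c) l<j′
      before-cut f f′ on on′ (K∃ φ) al {i = zero} i<c (b , h) =
        b , before-cut f f′ on on′ φ (subpatterns ∘ al) i<c h
      before-cut f f′ on on′ (K∃ φ) al {i = suc _} i<c =
        before-cut f f′ on on′ φ (subpatterns ∘ al) i<c
      before-cut f f′ on on′ (KK g φ) al {a} i<c h b a~b =
        before-cut f f′ on on′ φ (subpatterns ∘ al) i<c
          (h b (Indist-early f′ f {g} {a} {b} i<c a~b))

-- Two assignments that the sentence cannot tell apart

module _ {k m : ℕ} (Obs : Fin k → Subset (suc m)) (ψ : KForm k (suc m)) where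

  private
    N : ℕ
    -- One word more than there are patterns.
    N = suc (#patterns ψ)

  open Words N

  private
    structure : (Fin (suc N) → Fin N) → Kripke (suc m) (suc (suc N * suc end))
    structure f = Star.star (traces f) (traces-start f) (traces-stable f)

  -- Word j is read twice, by path `zero` and by path `suc j`, so `merging` holds.
  assign : Fin N → Fin (suc N) → Fin N
  assign j zero    = j
  assign j (suc w) = w

  -- Path `suc j` gives up its word for i, which leaves j to path `zero` alone. No word is lost, so
  -- the assignment stays onto.
  reassign : Fin N → Fin N → Fin (suc N) → Fin N
  reassign i j zero    = j
  reassign i j (suc w) = if does (w ≟ j) then i else w

  module _ {i j : Fin N} (i≢j : i ≢ j) where

    reassign-unique : ∀ w → j ≢ reassign i j (suc w)
    reassign-unique w with w ≟ j
    ... | yes _   = i≢j ∘ sym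
    ... | no  w≢j = w≢j ∘ sym

    reassign-onto : Onto (reassign i j)
    reassign-onto w with w ≟ j
    ... | yes w≡j = zero , sym w≡j
    ... | no  w≢j = suc w , cong (if_then i else w) (dec-false (w ≟ j) w≢j)

  assign-onto : ∀ j → Onto (assign j)
  assign-onto j w = suc w , refl

  -- The pigeonhole principle gives two words with the same pattern, and only path `suc j` changes
  -- its word, from one of them to the other. Here `assign zero` is the reference assignment.
  indistinguishable-words : ∃ λ i → ∃ λ j → i ≢ j ×
    Alike Obs (assign zero) (λ _ → refl) (assign j) (reassign i j) ψ
  indistinguishable-words
    with i , j , i<j , eq ← pigeonhole (n<1+n _)
           (λ w → pattern-of (holds Obs (assign zero) (λ _ → refl) w) ψ) =
    i , j , <⇒≢ i<j , alike
    where
    alike : Alike Obs (assign zero) (λ _ → refl) (assign j) (reassign i j) ψ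
    alike zero = same-pattern refl
    alike (suc w) with w ≟ j
    ... | yes refl = same-pattern (sym eq)
    ... | no  _    = same-pattern refl

  -- If ψ fails for `assign j`, that structure separates the sentences. Otherwise ψ also holds for
  -- `reassign i j`, where `merging` fails. Decidability of `Sat` allows this case distinction.
  not-equivalent : ∃ λ n → Σ (Kripke (suc m) n) λ K →
    ¬ ((K ⊨HyperCTL merging) ⇔ (K , Obs ⊨KCTL ψ))
  not-equivalent with indistinguishable-words
  ... | i , j , i≢j , alike
    with any? (λ a → Sat? Obs (traces (assign j)) (traces-stable (assign j)) ψ a 0)
  ... | no  unsat = _ , structure (assign j) , λ iff → unsat
    (Equivalence.to (Star.⊨KCTL⇔Sat _ _ _ Obs ψ) (Equivalence.to iff
      (Merging⇒⊨merging _ _ _ (merging-traces (assign j) j refl))))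
  ... | yes (a , sat) = _ , structure (reassign i j) , λ iff →
    ¬merging-traces (reassign i j) (reassign-unique i≢j)
      (⊨merging⇒Merging _ _ _ (Equivalence.from iff
        (Equivalence.from (Star.⊨KCTL⇔Sat _ _ _ Obs ψ) (a ,
          Sat-early Obs (assign zero) (λ _ → refl) (assign j) (reassign i j)
            (assign-onto j) (reassign-onto i≢j) ψ alike z≤n sat))))

theorem1 : ∀ (m : ℕ) →
    ∃ λ (v : ℕ) → Σ (HForm (suc m) v) λ φ →
    IsHyperLTLSentence φ ×
    (∀ (k : ℕ) (Obs : Fin k → Subset (suc m)) (ψ : KForm k (suc m)) →
    KSentence ψ →
    ∃ λ (n : ℕ) → Σ (Kripke (suc m) n) λ K →
    ¬ ((K ⊨HyperCTL φ) ⇔ (K , Obs ⊨KCTL ψ)))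
theorem1 m = 2 , merging , merging-sentence , λ k Obs ψ _ → not-equivalent Obs ψ
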